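{- For any permutation $\pi$ of $[n]$, the inversion graph $G_{\pi}$ has lettericity at most $\lceil n/2 \rceil$.
   Context: For a permutation $\pi$ of $[n]=\{1,\dots,n\}$, an inversion is a pair of indices $(i,j)$ with $i<j$ and $\pi(i)>\pi(j)$. The inversion graph $G_\pi$ is the graph with vertex set $[n]$ and edge set $\{\pi(i)\pi(j): i<j,\ \pi(i)>\pi(j)\}$. Given a finite alphabet $\Sigma$, a decoder is a set of ordered pairs $D\subseteq\Sigma^2$. For a word $w$ with letters $w(1),\dots,w(n)\in\Sigma$, the letter graph $\Gamma_D(w)$ is the graph with vertex set $\{1,\dots,n\}$ and with an edge $ij$ for each $i<j$ such that $(w(i),w(j))\in D$. If $|\Sigma|=k$, then $\Gamma_D(w)$ is called a $k$-letter graph. The lettericity of a graph $G$ is the least integer $k$ such that $G$ is isomorphic to a $k$-letter graph. -}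

module Defs where

open import Data.Bool.Base using (Bool; true; false; T)
open import Data.Bool.Properties using (T?)
open import Data.Fin.Base using (Fin; _<_; _>_)
open import Data.Fin.Properties using (all?; any?; _≟_; _<?_; <-irrefl; <-cmp)
open import Data.Fin.Permutation
  using (Permutation; Permutation′; permutation; _⟨$⟩ʳ_; _⟨$⟩ˡ_; inverseˡ; inverseʳ; ↔⇒≡)
open import Data.Nat.Base as ℕ using (ℕ; zero; suc; z≤n; s≤s)
open import Data.Product using (Σ-syntax; ∃; ∃-syntax; ∃₂; _×_; _,_; proj₁; proj₂)
open import Data.Sum.Base using (inj₁; inj₂)
open import Data.Vec.Base using (Vec; []; _∷_; lookup; tabulate)
open import Data.Vec.Properties using (lookup∘tabulate)
open import Function.Base using (_∘_; id)
open import Function.Bundles using (_⇔_; mk⇔; Equivalence)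
open import Function.Construct.Identity using (↔-id)
open import Level using (0ℓ)
open import Relation.Binary.Core using (Rel; _⇒_)
open import Relation.Binary.Construct.Closure.Symmetric as SymClosure using (SymClosure; fwd; bwd)
open import Relation.Binary.Definitions using (Decidable; Irreflexive; Symmetric; tri<; tri≈; tri>)
open import Relation.Binary.PropositionalEquality
  using (_≡_; refl; sym; trans; cong; cong₂; subst)
open import Relation.Nullary using (Dec; yes; no; contradiction)
open import Relation.Nullary.Decidable using (isYes; fromWitness; toWitness; map′; _×-dec_; _⊎-dec_; _→-dec_)
open import Relation.Unary as Unary using (Pred)

private
  variable
    k m n : ℕ

-- The vertex set [n] is represented by Fin n, so labels start at 0.
record Graph (n : ℕ) : Set₁ where
  field
    Adj    : Rel (Fin n) 0ℓ
    symm   : Symmetric Adj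
    irrefl : Irreflexive _≡_ Adj
    adj?   : Decidable Adj

open Graph using (Adj; adj?)

graphOf : (R : Rel (Fin n) 0ℓ) → Irreflexive _≡_ R → Decidable R → Graph n
graphOf R irr R? = record
  { Adj    = SymClosure R
  ; symm   = SymClosure.symmetric R
  ; irrefl = λ { refl (fwd r) → irr refl r ; refl (bwd r) → irr refl r }
  ; adj?   = λ u v → map′
      (λ { (inj₁ r) → fwd r ; (inj₂ r) → bwd r })
      (λ { (fwd r) → inj₁ r ; (bwd r) → inj₂ r })
      (R? u v ⊎-dec R? v u)
  }

infix 4 _≅_

_≅_ : Graph m → Graph n → Set
_≅_ {m} {n} G H =
  Σ[ φ ∈ Permutation m n ] ∀ u v → Adj G u v ⇔ Adj H (φ ⟨$⟩ʳ u) (φ ⟨$⟩ʳ v)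

Inversion : Permutation′ n → Rel (Fin n) 0ℓ
Inversion π i j = i < j × (π ⟨$⟩ʳ i) > (π ⟨$⟩ʳ j)

inversion? : (π : Permutation′ n) → Decidable (Inversion π)
inversion? π i j = (i <? j) ×-dec ((π ⟨$⟩ʳ j) <? (π ⟨$⟩ʳ i))

-- Vertices are the values of π, not its positions.
InversionEdge : Permutation′ n → Rel (Fin n) 0ℓ
InversionEdge π u v =
  ∃₂ λ i j → Inversion π i j × u ≡ π ⟨$⟩ʳ i × v ≡ π ⟨$⟩ʳ j

inversionGraph : Permutation′ n → Graph n
inversionGraph π = graphOf (InversionEdge π)
  (λ { refl (i , j , (_ , πj<πi) , p , q) → <-irrefl (trans (sym q) p) πj<πi })
  (λ u v → any? λ i → any? λ j →
     inversion? π i j ×-dec (u ≟ π ⟨$⟩ʳ i) ×-dec (v ≟ π ⟨$⟩ʳ j))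

-- An alphabet of size k is Fin k; a decoder is given by its indicator function.
Decoder : ℕ → Set
Decoder k = Fin k → Fin k → Bool

Word : ℕ → ℕ → Set
Word k n = Fin n → Fin k

LetterEdge : Decoder k → Word k n → Rel (Fin n) 0ℓ
LetterEdge D w i j = i < j × T (D (w i) (w j))

letterGraph : Decoder k → Word k n → Graph n
letterGraph D w = graphOf (LetterEdge D w)
  (λ { refl (i<i , _) → <-irrefl refl i<i })
  (λ i j → (i <? j) ×-dec T? (D (w i) (w j)))

-- The alphabet has exactly k letters, but w need not use all of them.
IsLetterGraph : ℕ → Graph n → Set
IsLetterGraph k G =
  ∃[ m ] Σ[ D ∈ Decoder k ] Σ[ w ∈ Word k m ] G ≅ letterGraph D w

IsLettericity : Graph n → ℕ → Set
IsLettericity G k = IsLetterGraph k G × (∀ j → IsLetterGraph j G → k ℕ.≤ j)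

private
  -- IsLetterGraph k G is decided by exhaustive search over vectors, which,
  -- unlike functions, can be enumerated up to propositional equality.
  Searchable : Set → Set₁
  Searchable A = {P : Pred A 0ℓ} → Unary.Decidable P → Dec (∃ P)

  searchBool : Searchable Bool
  searchBool P? with P? true | P? false
  ... | yes p | _     = yes (true , p)
  ... | no _  | yes p = yes (false , p)
  ... | no ¬t | no ¬f = no λ { (true , p) → ¬t p ; (false , p) → ¬f p }

  searchVec : {A : Set} → Searchable A → ∀ n → Searchable (Vec A n)
  searchVec s zero    P? = map′ ([] ,_) (λ { ([] , p) → p }) (P? [])
  searchVec s (suc n) P? = map′
    (λ { (x , xs , p) → x ∷ xs , p })
    (λ { (x ∷ xs , p) → x , xs , p })
    (s λ x → searchVec s n λ xs → P? (x ∷ xs))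

  _⇔?_ : {A B : Set} → Dec A → Dec B → Dec (A ⇔ B)
  a? ⇔? b? = map′
    (λ { (f , g) → mk⇔ f g })
    (λ e → Equivalence.to e , Equivalence.from e)
    ((a? →-dec b?) ×-dec (b? →-dec a?))

  decode : Vec (Vec Bool k) k → Decoder k
  decode D a b = lookup (lookup D a) b

  encode : Decoder k → Vec (Vec Bool k) k
  encode D = tabulate (tabulate ∘ D)

  decode-encode : (D : Decoder k) → ∀ a b → decode (encode D) a b ≡ D a b
  decode-encode D a b = trans
    (cong (λ r → lookup r b) (lookup∘tabulate (tabulate ∘ D) a))
    (lookup∘tabulate (D a) b)

  Code : ℕ → Graph n → Set
  Code {n} k G =
    Σ[ D ∈ Vec (Vec Bool k) k ] Σ[ w ∈ Vec (Fin k) n ]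
    Σ[ f ∈ Vec (Fin n) n ] Σ[ g ∈ Vec (Fin n) n ]
      (∀ i → lookup f (lookup g i) ≡ i) × (∀ i → lookup g (lookup f i) ≡ i) ×
      (∀ u v → Adj G u v ⇔ Adj (letterGraph (decode D) (lookup w)) (lookup f u) (lookup f v))

  code? : ∀ k (G : Graph n) → Dec (Code k G)
  code? {n} k G =
    searchVec (searchVec searchBool k) k λ D → searchVec any? n λ w →
    searchVec any? n λ f → searchVec any? n λ g →
      all? (λ i → lookup f (lookup g i) ≟ i) ×-dec
      all? (λ i → lookup g (lookup f i) ≟ i) ×-dec
      all? (λ u → all? λ v → adj? G u v ⇔?
        adj? (letterGraph (decode D) (lookup w)) (lookup f u) (lookup f v))

  code⇒ : (G : Graph n) → Code k G → IsLetterGraph k G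
  code⇒ {n} G (D , w , f , g , fg , gf , e) =
    n , decode D , lookup w , permutation (lookup f) (lookup g) fg gf , e

  letterEdge-cong : {D D′ : Decoder k} {w w′ : Word k n} →
    (∀ a b → D a b ≡ D′ a b) → (∀ i → w i ≡ w′ i) → LetterEdge D w ⇒ LetterEdge D′ w′
  letterEdge-cong {D′ = D′} p q {i} {j} (i<j , t) =
    i<j , subst T (trans (p _ _) (cong₂ D′ (q i) (q j))) t

  ⇒code : (G : Graph n) → IsLetterGraph k G → Code k G
  ⇒code G (m , D , w , φ , e) with refl ← ↔⇒≡ φ =
    encode D , tabulate w , tabulate f , tabulate g , fg , gf , e′
    where
    f = φ ⟨$⟩ʳ_
    g = φ ⟨$⟩ˡ_
    f≡ = lookup∘tabulate f
    g≡ = lookup∘tabulate g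
    fg : ∀ i → lookup (tabulate f) (lookup (tabulate g) i) ≡ i
    fg i = trans (f≡ _) (trans (cong f (g≡ i)) (inverseʳ φ))
    gf : ∀ i → lookup (tabulate g) (lookup (tabulate f) i) ≡ i
    gf i = trans (g≡ _) (trans (cong g (f≡ i)) (inverseˡ φ))
    e′ : ∀ u v → Adj G u v ⇔ Adj (letterGraph (decode (encode D)) (lookup (tabulate w)))
                                 (lookup (tabulate f) u) (lookup (tabulate f) v)
    e′ u v rewrite f≡ u | f≡ v = mk⇔
      (SymClosure.map (letterEdge-cong (λ a b → sym (decode-encode D a b))
                                       (λ i → sym (lookup∘tabulate w i)))
        ∘ Equivalence.to (e u v))
      (Equivalence.from (e u v)
        ∘ SymClosure.map (letterEdge-cong (decode-encode D) (lookup∘tabulate w)))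

  least : {P : Pred ℕ 0ℓ} → Unary.Decidable P → ∀ n → P n →
          ∃[ k ] P k × (∀ j → P j → k ℕ.≤ j)
  least P? n p with P? zero
  least P? n       p | yes p₀ = zero , p₀ , λ _ _ → z≤n
  least P? zero    p | no ¬p₀ = contradiction p ¬p₀
  least P? (suc n) p | no ¬p₀ with k , pk , min ← least (P? ∘ suc) n p =
    suc k , pk , λ { zero p₀ → contradiction p₀ ¬p₀ ; (suc j) pj → s≤s (min j pj) }

isLetterGraph? : ∀ k (G : Graph n) → Dec (IsLetterGraph k G)
isLetterGraph? k G = map′ (code⇒ G) (⇒code G) (code? k G)

isLetterGraph-order : (G : Graph n) → IsLetterGraph n G
isLetterGraph-order {n} G = n , D , id , ↔-id _ , λ u v → mk⇔ (to u v) from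
  where
  D : Decoder n
  D a b = isYes (adj? G a b)
  to : ∀ u v → Adj G u v → Adj (letterGraph D id) u v
  to u v a with <-cmp u v
  ... | tri< u<v _ _ = fwd (u<v , fromWitness {a? = adj? G u v} a)
  ... | tri≈ _ u≡v _ = contradiction a (Graph.irrefl G u≡v)
  ... | tri> _ _ v<u = bwd (v<u , fromWitness {a? = adj? G v u} (Graph.symm G a))
  from : ∀ {u v} → Adj (letterGraph D id) u v → Adj G u v
  from {u} {v} (fwd (_ , t)) = toWitness {a? = adj? G u v} t
  from {u} {v} (bwd (_ , t)) = Graph.symm G (toWitness {a? = adj? G v u} t)

lettericity-exists : (G : Graph n) → ∃[ k ] IsLettericity G k
lettericity-exists {n} G =
  least (λ k → isLetterGraph? k G) n (isLetterGraph-order G)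

lettericity : Graph n → ℕ
lettericity G = proj₁ (lettericity-exists G)

lettericity-isLettericity : (G : Graph n) → IsLettericity G (lettericity G)
lettericity-isLettericity G = proj₂ (lettericity-exists G)

{-# OPTIONS --safe #-}

-- Read the vertices (the values of π) in increasing order as a word, and let
-- the letter of a value be ⌊p/2⌋ where p is its position. If two values carry
-- different letters, the letters determine the order of the positions. If they
-- carry the same letter, they are the only two values with that letter, so
-- whether they form an inversion can be recorded in the decoder.
module Submission where

open import Defs
open import Data.Fin.Base using (Fin; toℕ; fromℕ<; _<_)
open import Data.Fin.Permutation using (Permutation′; _⟨$⟩ʳ_; _⟨$⟩ˡ_; inverseˡ; inverseʳ)
open import Data.Fin.Properties using (any?; _≟_; toℕ<n; toℕ-fromℕ<; toℕ-injective; <-asym; <-irrefl; <-cmp)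
open import Data.Nat using (ℕ; _≤_; ⌈_/2⌉; ⌊_/2⌋; zero; suc; s≤s; _*_)
import Data.Nat as ℕ
open import Data.Nat.Properties using (⌊n/2⌋-mono; *-suc; <⇒≤; ≤-antisym; suc-injective)
open import Data.Product using (∃₂; _×_; _,_; proj₁; proj₂)
open import Function.Base using (_∘_)
open import Function.Bundles using (mk⇔)
open import Function.Construct.Identity using (↔-id)
open import Relation.Binary.Construct.Closure.Symmetric using (fwd; bwd)
open import Relation.Binary.Definitions using (tri<; tri≈; tri>)
open import Relation.Binary.PropositionalEquality using (_≡_; refl; sym; trans; cong; subst₂)
open import Relation.Nullary using (Dec; contradiction)
open import Relation.Nullary.Decidable using (isYes; fromWitness; toWitness; _×-dec_)

private
  variable
    n : ℕ

-- Each fibre of halving is a pair 2k, 2k+1. Induction in steps of two reduces to the fibre of 0,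
-- whose only increasing pair is 0, 1.
<∧⌊/2⌋≡⇒consecutive : ∀ {a b} → a ℕ.< b → ⌊ a /2⌋ ≡ ⌊ b /2⌋ →
                      a ≡ 2 * ⌊ a /2⌋ × b ≡ suc (2 * ⌊ a /2⌋)
<∧⌊/2⌋≡⇒consecutive {zero}        {suc zero}    _               _ = refl , refl
<∧⌊/2⌋≡⇒consecutive {suc zero}    {suc zero}    (s≤s ())
<∧⌊/2⌋≡⇒consecutive {suc (suc a)} {suc (suc b)} (s≤s (s≤s a<b)) e
  with p , q ← <∧⌊/2⌋≡⇒consecutive a<b (suc-injective e)
  rewrite *-suc 2 ⌊ a /2⌋ = cong (suc ∘ suc) p , cong (suc ∘ suc) q

letter : Fin n → Fin ⌈ n /2⌉
-- `⌈ n /2⌉` unfolds to `⌊ suc n /2⌋`, so i + 2 ≤ n + 1 halves to the strict bound.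
letter i = fromℕ< (⌊n/2⌋-mono (s≤s (toℕ<n i)))

toℕ-letter : (i : Fin n) → toℕ (letter i) ≡ ⌊ toℕ i /2⌋
toℕ-letter i = toℕ-fromℕ< _

letter≡⇒⌊/2⌋≡ : {i j : Fin n} → letter i ≡ letter j → ⌊ toℕ i /2⌋ ≡ ⌊ toℕ j /2⌋
letter≡⇒⌊/2⌋≡ {i = i} {j} e = trans (sym (toℕ-letter i)) (trans (cong toℕ e) (toℕ-letter j))

-- Halving is monotone, so the halves satisfy i ≤ j = j′ ≤ i′ = i and all four coincide. One fibre
-- has only two members: `i` and `j′` are the even one, `j` and `i′` the odd one.
letters-crossed⇒swapped : {i j i′ j′ : Fin n} → letter i ≡ letter i′ → letter j ≡ letter j′ →
                          i < j → j′ < i′ → i ≡ j′ × j ≡ i′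
letters-crossed⇒swapped {i = i} {j} {i′} {j′} ei ej i<j j′<i′ =
  toℕ-injective (trans (proj₁ ij) (trans (cong (2 *_) i≡j′) (sym (proj₁ j′i′)))) ,
  toℕ-injective (trans (proj₂ ij) (trans (cong (suc ∘ (2 *_)) i≡j′) (sym (proj₂ j′i′))))
  where
  i≡i′ = letter≡⇒⌊/2⌋≡ {i = i} {i′} ei
  j≡j′ = letter≡⇒⌊/2⌋≡ {i = j} {j′} ej
  i≤j : ⌊ toℕ i /2⌋ ≤ ⌊ toℕ j /2⌋
  i≤j = ⌊n/2⌋-mono (<⇒≤ i<j)
  j′≤i′ : ⌊ toℕ j′ /2⌋ ≤ ⌊ toℕ i′ /2⌋
  j′≤i′ = ⌊n/2⌋-mono (<⇒≤ j′<i′)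
  i≡j : ⌊ toℕ i /2⌋ ≡ ⌊ toℕ j /2⌋
  i≡j = ≤-antisym i≤j (subst₂ _≤_ (sym j≡j′) (sym i≡i′) j′≤i′)
  i≡j′ = trans i≡j j≡j′
  ij = <∧⌊/2⌋≡⇒consecutive i<j i≡j
  j′i′ = <∧⌊/2⌋≡⇒consecutive j′<i′ (trans (sym i≡j′) i≡i′)

module _ (π : Permutation′ n) where

  -- Makes the decoder sound: an inversion at some positions carries over to any positions with the
  -- same letters, once the values there are in the right order.
  inversion-by-letters : ∀ {i j i′ j′} → letter i ≡ letter i′ → letter j ≡ letter j′ →
                         Inversion π i j → π ⟨$⟩ʳ j′ < π ⟨$⟩ʳ i′ → Inversion π i′ j′
  inversion-by-letters {i′ = i′} {j′} ei ej (i<j , πj<πi) πj′<πi′ with <-cmp i′ j′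
  ... | tri< i′<j′ _ _ = i′<j′ , πj′<πi′
  ... | tri≈ _ refl _  = contradiction πj′<πi′ (<-irrefl refl)
  -- The letters cross, so `i′` is `j` and `j′` is `i`; the assumed order of values then reverses
  -- that of the given inversion.
  ... | tri> _ _ j′<i′ with refl , refl ← letters-crossed⇒swapped ei ej i<j j′<i′ =
    contradiction πj′<πi′ (<-asym πj<πi)

  -- The word lists smaller values first, and the smaller value of an inversion has the later
  -- position; hence `a` belongs to `j` and `b` to `i`.
  InvertedLetters : Fin ⌈ n /2⌉ → Fin ⌈ n /2⌉ → Set
  InvertedLetters a b = ∃₂ λ i j → Inversion π i j × letter i ≡ b × letter j ≡ a

  invertedLetters? : ∀ a b → Dec (InvertedLetters a b)
  invertedLetters? a b = any? λ i → any? λ j →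
    inversion? π i j ×-dec (letter i ≟ b) ×-dec (letter j ≟ a)

  decoder : Decoder ⌈ n /2⌉
  decoder a b = isYes (invertedLetters? a b)

  word : Word ⌈ n /2⌉ n
  word u = letter (π ⟨$⟩ˡ u)

  inversionEdge⇒letterEdge : ∀ {u v} → InversionEdge π u v → LetterEdge decoder word v u
  inversionEdge⇒letterEdge (i , j , inv@(_ , πj<πi) , refl , refl) =
    πj<πi , fromWitness {a? = invertedLetters? _ _}
      (i , j , inv , cong letter (sym (inverseˡ π)) , cong letter (sym (inverseˡ π)))

  letterEdge⇒inversionEdge : ∀ {u v} → LetterEdge decoder word v u → InversionEdge π u v
  letterEdge⇒inversionEdge {u} {v} (v<u , t)
    with i , j , inv , ei , ej ← toWitness {a? = invertedLetters? (word v) (word u)} t =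
    -- The decoded `i` and `j` need only share letters with the positions of `u` and `v`.
    π ⟨$⟩ˡ u , π ⟨$⟩ˡ v ,
    inversion-by-letters ei ej inv (subst₂ _<_ (sym (inverseʳ π)) (sym (inverseʳ π)) v<u) ,
    sym (inverseʳ π) , sym (inverseʳ π)

  inversionGraph-isLetterGraph : IsLetterGraph ⌈ n /2⌉ (inversionGraph π)
  inversionGraph-isLetterGraph = n , decoder , word , ↔-id _ , λ u v → mk⇔
    -- Inversion edges run from the larger value to the smaller, letter edges the other way, so the
    -- directions swap.
    (λ { (fwd e) → bwd (inversionEdge⇒letterEdge e) ; (bwd e) → fwd (inversionEdge⇒letterEdge e) })
    (λ { (fwd e) → bwd (letterEdge⇒inversionEdge e) ; (bwd e) → fwd (letterEdge⇒inversionEdge e) })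

theorem3p3p1 : ∀ (n : ℕ) (π : Permutation′ n) → lettericity (inversionGraph π) ≤ ⌈ n /2⌉
theorem3p3p1 n π =
  proj₂ (lettericity-isLettericity (inversionGraph π)) ⌈ n /2⌉ (inversionGraph-isLetterGraph π)
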